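{- For any $\epsilon$ with $\frac{1}{2W}\le\epsilon\le\frac14$, the ratio between the memory consumption $\frac{1}{2\epsilon}+2\log W+O(1)$ (in bits) of Algorithm 1 for Basic-Counting and the lower bound $\max\left\{\log W,\frac{1}{2\epsilon+W^{ -1}}\right\}$ for $W\epsilon$-additive approximations for Basic-Counting satisfies $$\frac{\frac{1}{2\epsilon}+2\log W+O(1)}{\max\left\{\log W,\ \frac{1}{2\epsilon+W^{ -1}}\right\}}\le 3+o(1).$$
   Context: All logarithms are base 2; $W$ is a positive integer (the window size); $O(1)$ denotes a quantity bounded by an absolute constant; $o(1)$ is for $W\to\infty$, uniformly over the allowed $\epsilon$. Basic-Counting: given a stream of bits arriving one at a time, maintain $C^W$, the number of 1's among the last $W$ bits; a $W\epsilon$-additive approximation is an estimate within $W\epsilon$ of $C^W$ at all times. Algorithm 1 (with $k=\frac1{2\epsilon}$ and $\frac Wk$ assumed integers). Variables: integers $y,m,i,B$ and a bit array $b=(b_0,\dots,b_{k-1})$, all initialized to $0$. Add(bit $x$): if $m=\frac Wk-1$, then do in order $B\leftarrow B-b_i$; if $y+x\ge\frac Wk$ set $b_i\leftarrow1$, $y\leftarrow y-\frac Wk+x$, otherwise set $b_i\leftarrow0$, $y\leftarrow y+x$; $B\leftarrow B+b_i$; $m\leftarrow0$; $i\leftarrow i+1\bmod k$. If $m\ne\frac Wk-1$: $y\leftarrow y+x$, $m\leftarrow m+1$. Query: return $\frac Wk B+y-\frac W{2k}-m\,b_i$. Its memory consumption is $\frac{1}{2\epsilon}+2\log W+O(1)$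 bits. -}

module Defs where

open import Data.Integer.Base as ℤ using (+_)
import Data.Integer.Properties as ℤ
open import Data.Nat.Base as ℕ using (ℕ; zero; suc; NonZero)
open import Data.Nat.Induction using (<-rec)
open import Data.Nat.Logarithm
import Data.Nat.Properties as ℕ
open import Data.Product.Base using (Σ; _×_; _,_; ∃-syntax; proj₁; proj₂)
open import Data.Rational.Base as ℚ using (ℚ; 0ℚ; 1ℚ; ½)
import Data.Rational.Properties as ℚ
open import Data.Rational.Solver using (module +-*-Solver)
open import Data.Rational.Unnormalised.Base as ℚᵘ using (mkℚᵘ; *≤*)
import Data.Rational.Unnormalised.Properties as ℚᵘ
open import Data.Sum.Base using (_⊎_; inj₁; inj₂)
open import Relation.Binary.PropositionalEquality
open import Relation.Nullary using (yes; no; contradiction)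

-- Cauchy sequences of rationals. No eta, so that e.g. x * y is a stuck term
-- and instance search can decompose it.
record ℝ : Set where
  no-eta-equality
  field
    seq    : ℕ → ℚ
    cauchy : ∀ δ .{{_ : ℚ.Positive δ}} → ∃[ N ] ∀ {m n} → N ℕ.≤ m → N ℕ.≤ n →
             ℚ.∣ seq m ℚ.- seq n ∣ ℚ.≤ δ

open ℝ public

infix 4 _≤_

_≤_ : ℝ → ℝ → Set
x ≤ y = ∀ δ .{{_ : ℚ.Positive δ}} → ∃[ N ] ∀ {n} → N ℕ.≤ n → seq x n ℚ.≤ seq y n ℚ.+ δ

record Positive (x : ℝ) : Set where
  no-eta-equality
  field
    bound   : ℚ
    bound>0 : ℚ.Positive bound
    from    : ℕ
    bound≤  : ∀ {n} → from ℕ.≤ n → bound ℚ.≤ seq x n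

open Positive

p≤∣p∣ : ∀ p → p ℚ.≤ ℚ.∣ p ∣
p≤∣p∣ p with ℚ.≤-total 0ℚ p
... | inj₁ 0≤p = ℚ.≤-reflexive (sym (ℚ.0≤p⇒∣p∣≡p 0≤p))
... | inj₂ p≤0 = ℚ.≤-trans p≤0 (ℚ.0≤∣p∣ p)

∣p-q∣≤δ⇒p≤q+δ : ∀ p q {δ} → ℚ.∣ p ℚ.- q ∣ ℚ.≤ δ → p ℚ.≤ q ℚ.+ δ
∣p-q∣≤δ⇒p≤q+δ p q {δ} h = begin
  p                ≡⟨ solve 2 (λ p q → p := q :+ (p :- q)) refl p q ⟩
  q ℚ.+ (p ℚ.- q)  ≤⟨ ℚ.+-monoʳ-≤ q (ℚ.≤-trans (p≤∣p∣ (p ℚ.- q)) h) ⟩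
  q ℚ.+ δ          ∎
  where
  open ℚ.≤-Reasoning
  open +-*-Solver

p≤q+δ⇒p-q≤δ : ∀ p q {δ} → p ℚ.≤ q ℚ.+ δ → p ℚ.- q ℚ.≤ δ
p≤q+δ⇒p-q≤δ p q {δ} h = begin
  p ℚ.- q          ≤⟨ ℚ.+-monoˡ-≤ (ℚ.- q) h ⟩
  q ℚ.+ δ ℚ.- q    ≡⟨ solve 2 (λ q δ → q :+ δ :- q := δ) refl q δ ⟩
  δ                ∎
  where
  open ℚ.≤-Reasoning
  open +-*-Solver

∣p-q∣≡∣q-p∣ : ∀ p q → ℚ.∣ p ℚ.- q ∣ ≡ ℚ.∣ q ℚ.- p ∣
∣p-q∣≡∣q-p∣ p q = trans (cong ℚ.∣_∣ (solve 2 (λ p q → p :- q := :- (q :- p)) refl p q))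
                        (ℚ.∣-p∣≡∣p∣ (q ℚ.- p))
  where
  open +-*-Solver

∣p-q∣-intro : ∀ p q {δ} → p ℚ.≤ q ℚ.+ δ → q ℚ.≤ p ℚ.+ δ → ℚ.∣ p ℚ.- q ∣ ℚ.≤ δ
∣p-q∣-intro p q {δ} h₁ h₂ with ℚ.∣p∣≡p∨∣p∣≡-p (p ℚ.- q)
... | inj₁ e = subst (ℚ._≤ δ) (sym e) (p≤q+δ⇒p-q≤δ p q h₁)
... | inj₂ e = subst (ℚ._≤ δ)
  (sym (trans e (solve 2 (λ p q → :- (p :- q) := q :- p) refl p q)))
  (p≤q+δ⇒p-q≤δ q p h₂)
  where
  open +-*-Solver

½*pos : ∀ δ .{{_ : ℚ.Positive δ}} → ℚ.Positive (½ ℚ.* δ)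
½*pos δ = ℚ.pos*pos⇒pos ½ δ

½δ+½δ≡δ : ∀ δ → ½ ℚ.* δ ℚ.+ ½ ℚ.* δ ≡ δ
½δ+½δ≡δ = solve 1 (λ δ → con ½ :* δ :+ con ½ :* δ := δ) refl
  where
  open +-*-Solver

⊔-close : ∀ p q r s {δ} → p ℚ.≤ r ℚ.+ δ → q ℚ.≤ s ℚ.+ δ → p ℚ.⊔ q ℚ.≤ (r ℚ.⊔ s) ℚ.+ δ
⊔-close _ _ r s {δ} h₁ h₂ = ℚ.⊔-lub
  (ℚ.≤-trans h₁ (ℚ.+-monoˡ-≤ δ (ℚ.p≤p⊔q r s)))
  (ℚ.≤-trans h₂ (ℚ.+-monoˡ-≤ δ (ℚ.p≤q⊔p r s)))

*-mono-≤ : ∀ {p q r s} → 0ℚ ℚ.≤ r → 0ℚ ℚ.≤ q → p ℚ.≤ q → r ℚ.≤ s → p ℚ.* r ℚ.≤ q ℚ.* s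
*-mono-≤ {p} {q} {r} {s} 0≤r 0≤q p≤q r≤s = ℚ.≤-trans
  (ℚ.*-monoʳ-≤-nonNeg r {{ℚ.nonNegative 0≤r}} p≤q)
  (ℚ.*-monoˡ-≤-nonNeg q {{ℚ.nonNegative 0≤q}} r≤s)

0≤pos : ∀ p .{{_ : ℚ.Positive p}} → 0ℚ ℚ.≤ p
0≤pos p = ℚ.<⇒≤ (ℚ.positive⁻¹ p)

pos-≤ : ∀ {p q} .{{_ : ℚ.Positive p}} → p ℚ.≤ q → ℚ.Positive q
pos-≤ {p} p≤q = ℚ.positive (ℚ.<-≤-trans (ℚ.positive⁻¹ p) p≤q)

recip : ∀ p .{{_ : ℚ.Positive p}} → ℚ
recip p = (ℚ.1/ p) {{ℚ.pos⇒nonZero p}}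

recip-pos : ∀ p .{{_ : ℚ.Positive p}} → ℚ.Positive (recip p)
recip-pos p = ℚ.1/pos⇒pos p

*-recip : ∀ p .{{_ : ℚ.Positive p}} → p ℚ.* recip p ≡ 1ℚ
*-recip p = ℚ.*-inverseʳ p {{ℚ.pos⇒nonZero p}}

recip-anti : ∀ p q .{{_ : ℚ.Positive p}} .{{_ : ℚ.Positive q}} → p ℚ.≤ q → recip q ℚ.≤ recip p
recip-anti p q p≤q = begin
  recip q                            ≡⟨ ℚ.*-identityˡ (recip q) ⟨
  1ℚ ℚ.* recip q                     ≡⟨ cong (ℚ._* recip q) (*-recip p) ⟨
  p ℚ.* recip p ℚ.* recip q          ≡⟨ cong (ℚ._* recip q) (ℚ.*-comm p (recip p)) ⟩
  recip p ℚ.* p ℚ.* recip q          ≡⟨ ℚ.*-assoc (recip p) p (recip q) ⟩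
  recip p ℚ.* (p ℚ.* recip q)        ≤⟨ ℚ.*-monoˡ-≤-nonNeg (recip p) {{ℚ.nonNegative (0≤pos (recip p) {{recip-pos p}})}}
                                          (ℚ.*-monoʳ-≤-nonNeg (recip q) {{ℚ.nonNegative (0≤pos (recip q) {{recip-pos q}})}} p≤q) ⟩
  recip p ℚ.* (q ℚ.* recip q)        ≡⟨ cong (recip p ℚ.*_) (*-recip q) ⟩
  recip p ℚ.* 1ℚ                     ≡⟨ ℚ.*-identityʳ (recip p) ⟩
  recip p                            ∎
  where
  open ℚ.≤-Reasoning

recip-diff : ∀ p q .{{_ : ℚ.Positive p}} .{{_ : ℚ.Positive q}} →
             recip p ℚ.- recip q ≡ recip p ℚ.* recip q ℚ.* (q ℚ.- p)
recip-diff p q = begin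
  p⁻¹ ℚ.- q⁻¹
    ≡⟨ cong₂ (λ u v → u ℚ.- v) (ℚ.*-identityʳ p⁻¹) (ℚ.*-identityʳ q⁻¹) ⟨
  p⁻¹ ℚ.* 1ℚ ℚ.- q⁻¹ ℚ.* 1ℚ
    ≡⟨ cong₂ (λ u v → p⁻¹ ℚ.* u ℚ.- q⁻¹ ℚ.* v) (*-recip q) (*-recip p) ⟨
  p⁻¹ ℚ.* (q ℚ.* q⁻¹) ℚ.- q⁻¹ ℚ.* (p ℚ.* p⁻¹)
    ≡⟨ solve 4 (λ p q u v → u :* (q :* v) :- v :* (p :* u) := u :* v :* (q :- p)) refl p q p⁻¹ q⁻¹ ⟩
  p⁻¹ ℚ.* q⁻¹ ℚ.* (q ℚ.- p)
    ∎
  where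
  open ≡-Reasoning
  open +-*-Solver
  p⁻¹ = recip p
  q⁻¹ = recip q

⊔-pos : ∀ p q .{{_ : ℚ.Positive q}} → ℚ.Positive (p ℚ.⊔ q)
⊔-pos p q = pos-≤ {q} (ℚ.p≤q⊔p p q)

/-mono : ∀ a b c d → a ℕ.* suc d ℕ.≤ c ℕ.* suc b → + a ℚ./ suc b ℚ.≤ + c ℚ./ suc d
/-mono a b c d h = ℚ.toℚᵘ-cancel-≤ (begin
  ℚ.toℚᵘ (+ a ℚ./ suc b)  ≃⟨ ℚ.toℚᵘ-fromℚᵘ (mkℚᵘ (+ a) b) ⟩
  mkℚᵘ (+ a) b            ≤⟨ *≤* (subst₂ ℤ._≤_ (ℤ.pos-* a (suc d)) (ℤ.pos-* c (suc b)) (ℤ.+≤+ h)) ⟩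
  mkℚᵘ (+ c) d            ≃⟨ ℚ.toℚᵘ-fromℚᵘ (mkℚᵘ (+ c) d) ⟨
  ℚ.toℚᵘ (+ c ℚ./ suc d)  ∎)
  where
  open ℚᵘ.≤-Reasoning

/-+ : ∀ a b c → + a ℚ./ suc c ℚ.+ + b ℚ./ suc c ≡ + (a ℕ.+ b) ℚ./ suc c
/-+ a b c = ℚ.toℚᵘ-injective (begin
  ℚ.toℚᵘ (+ a ℚ./ suc c ℚ.+ + b ℚ./ suc c)
    ≈⟨ ℚ.toℚᵘ-homo-+ (+ a ℚ./ suc c) (+ b ℚ./ suc c) ⟩
  ℚ.toℚᵘ (+ a ℚ./ suc c) ℚᵘ.+ ℚ.toℚᵘ (+ b ℚ./ suc c)
    ≈⟨ ℚᵘ.+-cong (ℚ.toℚᵘ-fromℚᵘ (mkℚᵘ (+ a) c)) (ℚ.toℚᵘ-fromℚᵘ (mkℚᵘ (+ b) c)) ⟩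
  mkℚᵘ (+ a) c ℚᵘ.+ mkℚᵘ (+ b) c
    ≈⟨ ℚᵘ.*≡* eq ⟩
  mkℚᵘ (+ (a ℕ.+ b)) c
    ≈⟨ ℚ.toℚᵘ-fromℚᵘ (mkℚᵘ (+ (a ℕ.+ b)) c) ⟨
  ℚ.toℚᵘ (+ (a ℕ.+ b) ℚ./ suc c) ∎)
  where
  open import Relation.Binary.Reasoning.Setoid ℚᵘ.≃-setoid
  eq : (+ a ℤ.* + suc c ℤ.+ + b ℤ.* + suc c) ℤ.* + suc c
       ≡ + (a ℕ.+ b) ℤ.* (+ suc c ℤ.* + suc c)
  eq = trans (cong (ℤ._* + suc c) (sym (ℤ.*-distribʳ-+ (+ suc c) (+ a) (+ b))))
             (ℤ.*-assoc (+ (a ℕ.+ b)) (+ suc c) (+ suc c))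

archimedean : ∀ δ .{{_ : ℚ.Positive δ}} → ∃[ N ] ∀ {n} → N ℕ.≤ n → + 1 ℚ./ suc n ℚ.≤ δ
archimedean δ@(ℚ.mkℚ (+ suc a) d _) = d , λ {n} d≤n →
  subst (+ 1 ℚ./ suc n ℚ.≤_) (ℚ.↥p/↧p≡p δ) (/-mono 1 n (suc a) d
    (ℕ.*-mono-≤ {1} {suc a} (ℕ.s≤s ℕ.z≤n) (ℕ.s≤s d≤n)))

⌊log₂⌋-lower : ∀ n .{{_ : NonZero n}} → 2 ℕ.^ ⌊log₂ n ⌋ ℕ.≤ n
⌊log₂⌋-lower n = <-rec (λ n → .{{_ : NonZero n}} → 2 ℕ.^ ⌊log₂ n ⌋ ℕ.≤ n) step n
  where
  2*⌊n/2⌋≤n : ∀ n → 2 ℕ.* ℕ.⌊ n /2⌋ ℕ.≤ n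
  2*⌊n/2⌋≤n zero = ℕ.z≤n
  2*⌊n/2⌋≤n (suc zero) = ℕ.z≤n
  2*⌊n/2⌋≤n (suc (suc n)) =
    subst (ℕ._≤ suc (suc n)) (sym (ℕ.*-suc 2 ℕ.⌊ n /2⌋)) (ℕ.s≤s (ℕ.s≤s (2*⌊n/2⌋≤n n)))

  step : ∀ n → (∀ {m} → m ℕ.< n → .{{_ : NonZero m}} → 2 ℕ.^ ⌊log₂ m ⌋ ℕ.≤ m) →
         .{{_ : NonZero n}} → 2 ℕ.^ ⌊log₂ n ⌋ ℕ.≤ n
  step 1 rec = ℕ.≤-refl
  step n@(suc (suc k)) rec = begin
    2 ℕ.^ ⌊log₂ n ⌋                        ≤⟨ ℕ.^-monoʳ-≤ 2 (ℕ.m≤n+m∸n ⌊log₂ n ⌋ 1) ⟩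
    2 ℕ.^ (1 ℕ.+ (⌊log₂ n ⌋ ℕ.∸ 1))        ≡⟨ cong (λ l → 2 ℕ.^ suc l) (⌊log₂⌊n/2⌋⌋≡⌊log₂n⌋∸1 n) ⟨
    2 ℕ.* 2 ℕ.^ ⌊log₂ ℕ.⌊ n /2⌋ ⌋          ≤⟨ ℕ.*-monoʳ-≤ 2 (rec (ℕ.⌊n/2⌋<n (suc k))) ⟩
    2 ℕ.* ℕ.⌊ n /2⌋                        ≤⟨ 2*⌊n/2⌋≤n n ⟩
    n                                      ∎
    where
    open ℕ.≤-Reasoning

⌊log₂⌋-upper : ∀ n → n ℕ.< 2 ℕ.^ suc ⌊log₂ n ⌋
⌊log₂⌋-upper n with n ℕ.<? 2 ℕ.^ suc ⌊log₂ n ⌋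
... | yes n< = n<
... | no n≮ = contradiction
  (subst (ℕ._≤ ⌊log₂ n ⌋) (⌊log₂[2^n]⌋≡n (suc ⌊log₂ n ⌋)) (⌊log₂⌋-mono-≤ (ℕ.≮⇒≥ n≮)))
  (ℕ.n≮n ⌊log₂ n ⌋)

fromℚ : ℚ → ℝ
seq (fromℚ q) n = q
cauchy (fromℚ q) δ = 0 , λ _ _ →
  subst (ℚ._≤ δ) (cong ℚ.∣_∣ (sym (ℚ.+-inverseʳ q))) (0≤pos δ)

-- Defined by copatterns rather than through fromℚ, again for instance search.
fromℕ : ℕ → ℝ
seq (fromℕ n) = seq (fromℚ (+ n ℚ./ 1))
cauchy (fromℕ n) = cauchy (fromℚ (+ n ℚ./ 1))

infixl 6 _+_
infixl 7 _*_
infix  8 -_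

_+_ : ℝ → ℝ → ℝ
seq (x + y) n = seq x n ℚ.+ seq y n
cauchy (x + y) δ
  with cauchy x (½ ℚ.* δ) {{½*pos δ}} | cauchy y (½ ℚ.* δ) {{½*pos δ}}
... | M , f | N , g = M ℕ.⊔ N , λ {m} {n} m≥ n≥ →
  let a = seq x m; b = seq x n; c = seq y m; d = seq y n in begin
    ℚ.∣ (a ℚ.+ c) ℚ.- (b ℚ.+ d) ∣
      ≡⟨ cong ℚ.∣_∣ (solve 4 (λ a b c d → (a :+ c) :- (b :+ d) := (a :- b) :+ (c :- d)) refl a b c d) ⟩
    ℚ.∣ (a ℚ.- b) ℚ.+ (c ℚ.- d) ∣
      ≤⟨ ℚ.∣p+q∣≤∣p∣+∣q∣ (a ℚ.- b) (c ℚ.- d) ⟩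
    ℚ.∣ a ℚ.- b ∣ ℚ.+ ℚ.∣ c ℚ.- d ∣
      ≤⟨ ℚ.+-mono-≤ (f (ℕ.m⊔n≤o⇒m≤o M N m≥) (ℕ.m⊔n≤o⇒m≤o M N n≥))
                    (g (ℕ.m⊔n≤o⇒n≤o M N m≥) (ℕ.m⊔n≤o⇒n≤o M N n≥)) ⟩
    ½ ℚ.* δ ℚ.+ ½ ℚ.* δ
      ≡⟨ ½δ+½δ≡δ δ ⟩
    δ ∎
  where
  open ℚ.≤-Reasoning
  open +-*-Solver

-_ : ℝ → ℝ
seq (- x) n = ℚ.- seq x n
cauchy (- x) δ with cauchy x δ
... | N , f = N , λ {m} {n} m≥ n≥ →
  subst (ℚ._≤ δ)
    (cong ℚ.∣_∣ (solve 2 (λ a b → b :- a := :- a :- :- b) refl (seq x m) (seq x n)))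
    (f n≥ m≥)
  where
  open +-*-Solver

infixl 6 _⊔_

_⊔_ : ℝ → ℝ → ℝ
seq (x ⊔ y) n = seq x n ℚ.⊔ seq y n
cauchy (x ⊔ y) δ with cauchy x δ | cauchy y δ
... | M , f | N , g = M ℕ.⊔ N , λ {m} {n} m≥ n≥ →
  ∣p-q∣-intro (seq (x ⊔ y) m) (seq (x ⊔ y) n) (half m≥ n≥) (half n≥ m≥)
  where
  half : ∀ {m n} → M ℕ.⊔ N ℕ.≤ m → M ℕ.⊔ N ℕ.≤ n →
         seq x m ℚ.⊔ seq y m ℚ.≤ (seq x n ℚ.⊔ seq y n) ℚ.+ δ
  half {m} {n} m≥ n≥ = ⊔-close (seq x m) (seq y m) (seq x n) (seq y n)
    (∣p-q∣≤δ⇒p≤q+δ (seq x m) (seq x n) (f (ℕ.m⊔n≤o⇒m≤o M N m≥) (ℕ.m⊔n≤o⇒m≤o M N n≥)))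
    (∣p-q∣≤δ⇒p≤q+δ (seq y m) (seq y n) (g (ℕ.m⊔n≤o⇒n≤o M N m≥) (ℕ.m⊔n≤o⇒n≤o M N n≥)))

∣_∣ : ℝ → ℝ
∣ x ∣ = x ⊔ - x

bounded : ∀ x → Σ ℚ λ B → ℚ.Positive B × ∃[ N ] ∀ {n} → N ℕ.≤ n → ℚ.∣ seq x n ∣ ℚ.≤ B
bounded x with cauchy x 1ℚ
... | N , f = B , B>0 , N , bound′
  where
  open ℚ.≤-Reasoning
  open +-*-Solver
  B : ℚ
  B = ℚ.∣ seq x N ∣ ℚ.+ 1ℚ
  B>0 : ℚ.Positive B
  B>0 = ℚ.nonNeg+pos⇒pos ℚ.∣ seq x N ∣ {{ℚ.∣-∣-nonNeg (seq x N)}} 1ℚ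
  bound′ : ∀ {n} → N ℕ.≤ n → ℚ.∣ seq x n ∣ ℚ.≤ B
  bound′ {n} n≥ = begin
    ℚ.∣ seq x n ∣
      ≡⟨ cong ℚ.∣_∣ (solve 2 (λ a b → a := b :+ (a :- b)) refl (seq x n) (seq x N)) ⟩
    ℚ.∣ seq x N ℚ.+ (seq x n ℚ.- seq x N) ∣
      ≤⟨ ℚ.∣p+q∣≤∣p∣+∣q∣ (seq x N) (seq x n ℚ.- seq x N) ⟩
    ℚ.∣ seq x N ∣ ℚ.+ ℚ.∣ seq x n ℚ.- seq x N ∣
      ≤⟨ ℚ.+-monoʳ-≤ ℚ.∣ seq x N ∣ (f n≥ ℕ.≤-refl) ⟩
    B ∎

_*_ : ℝ → ℝ → ℝ
seq (x * y) n = seq x n ℚ.* seq y n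
cauchy (x * y) δ = N , close
  where
  open ℚ.≤-Reasoning
  open +-*-Solver
  B = proj₁ (bounded x)
  C = proj₁ (bounded y)
  instance
    B>0 : ℚ.Positive B
    B>0 = proj₁ (proj₂ (bounded x))
    C>0 : ℚ.Positive C
    C>0 = proj₁ (proj₂ (bounded y))
    B+C>0 : ℚ.Positive (B ℚ.+ C)
    B+C>0 = ℚ.pos+pos⇒pos B C
    γ>0 : ℚ.Positive (recip (B ℚ.+ C) ℚ.* δ)
    γ>0 = ℚ.pos*pos⇒pos (recip (B ℚ.+ C)) {{recip-pos (B ℚ.+ C)}} δ
  γ = recip (B ℚ.+ C) ℚ.* δ
  M₁ = proj₁ (proj₂ (proj₂ (bounded x)))
  M₂ = proj₁ (proj₂ (proj₂ (bounded y)))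
  N₁ = proj₁ (cauchy x γ)
  N₂ = proj₁ (cauchy y γ)
  N = (M₁ ℕ.⊔ M₂) ℕ.⊔ (N₁ ℕ.⊔ N₂)
  close : ∀ {m n} → N ℕ.≤ m → N ℕ.≤ n →
          ℚ.∣ seq x m ℚ.* seq y m ℚ.- seq x n ℚ.* seq y n ∣ ℚ.≤ δ
  close {m} {n} m≥ n≥ = let a = seq x m; b = seq x n; c = seq y m; d = seq y n in begin
    ℚ.∣ a ℚ.* c ℚ.- b ℚ.* d ∣
      ≡⟨ cong ℚ.∣_∣ (solve 4 (λ a b c d → a :* c :- b :* d := a :* (c :- d) :+ d :* (a :- b)) refl a b c d) ⟩
    ℚ.∣ a ℚ.* (c ℚ.- d) ℚ.+ d ℚ.* (a ℚ.- b) ∣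
      ≤⟨ ℚ.∣p+q∣≤∣p∣+∣q∣ (a ℚ.* (c ℚ.- d)) (d ℚ.* (a ℚ.- b)) ⟩
    ℚ.∣ a ℚ.* (c ℚ.- d) ∣ ℚ.+ ℚ.∣ d ℚ.* (a ℚ.- b) ∣
      ≡⟨ cong₂ ℚ._+_ (ℚ.∣p*q∣≡∣p∣*∣q∣ a (c ℚ.- d)) (ℚ.∣p*q∣≡∣p∣*∣q∣ d (a ℚ.- b)) ⟩
    ℚ.∣ a ∣ ℚ.* ℚ.∣ c ℚ.- d ∣ ℚ.+ ℚ.∣ d ∣ ℚ.* ℚ.∣ a ℚ.- b ∣
      ≤⟨ ℚ.+-mono-≤
           (*-mono-≤ (ℚ.0≤∣p∣ (c ℚ.- d)) (0≤pos B)
             (proj₂ (proj₂ (proj₂ (bounded x))) (M₁≤ m≥)) (proj₂ (cauchy y γ) (N₂≤ m≥) (N₂≤ n≥)))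
           (*-mono-≤ (ℚ.0≤∣p∣ (a ℚ.- b)) (0≤pos C)
             (proj₂ (proj₂ (proj₂ (bounded y))) (M₂≤ n≥)) (proj₂ (cauchy x γ) (N₁≤ m≥) (N₁≤ n≥))) ⟩
    B ℚ.* γ ℚ.+ C ℚ.* γ
      ≡⟨ solve 4 (λ B C r δ → B :* (r :* δ) :+ C :* (r :* δ) := (B :+ C) :* r :* δ) refl
           B C (recip (B ℚ.+ C)) δ ⟩
    (B ℚ.+ C) ℚ.* recip (B ℚ.+ C) ℚ.* δ
      ≡⟨ cong (ℚ._* δ) (*-recip (B ℚ.+ C)) ⟩
    1ℚ ℚ.* δ
      ≡⟨ ℚ.*-identityˡ δ ⟩
    δ ∎
    where
    M₁≤ : ∀ {k} → N ℕ.≤ k → M₁ ℕ.≤ k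
    M₁≤ h = ℕ.m⊔n≤o⇒m≤o M₁ M₂ (ℕ.m⊔n≤o⇒m≤o (M₁ ℕ.⊔ M₂) (N₁ ℕ.⊔ N₂) h)
    M₂≤ : ∀ {k} → N ℕ.≤ k → M₂ ℕ.≤ k
    M₂≤ h = ℕ.m⊔n≤o⇒n≤o M₁ M₂ (ℕ.m⊔n≤o⇒m≤o (M₁ ℕ.⊔ M₂) (N₁ ℕ.⊔ N₂) h)
    N₁≤ : ∀ {k} → N ℕ.≤ k → N₁ ℕ.≤ k
    N₁≤ h = ℕ.m⊔n≤o⇒m≤o N₁ N₂ (ℕ.m⊔n≤o⇒n≤o (M₁ ℕ.⊔ M₂) (N₁ ℕ.⊔ N₂) h)
    N₂≤ : ∀ {k} → N ℕ.≤ k → N₂ ℕ.≤ k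
    N₂≤ h = ℕ.m⊔n≤o⇒n≤o N₁ N₂ (ℕ.m⊔n≤o⇒n≤o (M₁ ℕ.⊔ M₂) (N₁ ℕ.⊔ N₂) h)

-- Capping the terms from below by the positive rational bound q changes
-- only finitely many of them, and makes every term invertible.
inv : ∀ x {{_ : Positive x}} → ℝ
seq (inv x {{x>0}}) n = (ℚ.1/ (seq x n ℚ.⊔ bound x>0)) {{nz}}
  where nz = ℚ.pos⇒nonZero (seq x n ℚ.⊔ bound x>0) {{⊔-pos (seq x n) (bound x>0) {{bound>0 x>0}}}}
cauchy (inv x {{x>0}}) δ = proj₁ (cauchy x γ) , close
  where
  open ℚ.≤-Reasoning
  open +-*-Solver
  q = bound x>0
  instance
    q>0 : ℚ.Positive q
    q>0 = bound>0 x>0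
    c>0 : ∀ {n} → ℚ.Positive (seq x n ℚ.⊔ q)
    c>0 {n} = ⊔-pos (seq x n) q
    γ>0 : ℚ.Positive (q ℚ.* q ℚ.* δ)
    γ>0 = ℚ.pos*pos⇒pos (q ℚ.* q) {{ℚ.pos*pos⇒pos q q}} δ
  γ = q ℚ.* q ℚ.* δ
  q⁻¹ = recip q
  0≤r : ∀ p .{{_ : ℚ.Positive p}} → 0ℚ ℚ.≤ recip p
  0≤r p = 0≤pos (recip p) {{recip-pos p}}
  cap≤ : ∀ n → recip (seq x n ℚ.⊔ q) ℚ.≤ q⁻¹
  cap≤ n = recip-anti q (seq x n ℚ.⊔ q) (ℚ.p≤q⊔p (seq x n) q)
  half : ∀ {m n} → proj₁ (cauchy x γ) ℕ.≤ m → proj₁ (cauchy x γ) ℕ.≤ n →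
         seq x m ℚ.⊔ q ℚ.≤ (seq x n ℚ.⊔ q) ℚ.+ γ
  half {m} {n} m≥ n≥ = ⊔-close (seq x m) q (seq x n) q
    (∣p-q∣≤δ⇒p≤q+δ (seq x m) (seq x n) (proj₂ (cauchy x γ) m≥ n≥))
    (subst (ℚ._≤ q ℚ.+ γ) (ℚ.+-identityʳ q) (ℚ.+-monoʳ-≤ q (0≤pos γ)))
  close : ∀ {m n} → proj₁ (cauchy x γ) ℕ.≤ m → proj₁ (cauchy x γ) ℕ.≤ n →
          ℚ.∣ recip (seq x m ℚ.⊔ q) ℚ.- recip (seq x n ℚ.⊔ q) ∣ ℚ.≤ δ
  close {m} {n} m≥ n≥ = let a = seq x m ℚ.⊔ q; b = seq x n ℚ.⊔ q in begin
    ℚ.∣ recip a ℚ.- recip b ∣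
      ≡⟨ cong ℚ.∣_∣ (recip-diff a b) ⟩
    ℚ.∣ recip a ℚ.* recip b ℚ.* (b ℚ.- a) ∣
      ≡⟨ ℚ.∣p*q∣≡∣p∣*∣q∣ (recip a ℚ.* recip b) (b ℚ.- a) ⟩
    ℚ.∣ recip a ℚ.* recip b ∣ ℚ.* ℚ.∣ b ℚ.- a ∣
      ≡⟨ cong (ℚ._* ℚ.∣ b ℚ.- a ∣) (ℚ.0≤p⇒∣p∣≡p (0≤pos (recip a ℚ.* recip b)
           {{ℚ.pos*pos⇒pos (recip a) {{recip-pos a}} (recip b) {{recip-pos b}}}})) ⟩
    recip a ℚ.* recip b ℚ.* ℚ.∣ b ℚ.- a ∣
      ≤⟨ *-mono-≤ (ℚ.0≤∣p∣ (b ℚ.- a)) (0≤pos (q⁻¹ ℚ.* q⁻¹) {{ℚ.pos*pos⇒pos q⁻¹ {{recip-pos q}} q⁻¹ {{recip-pos q}}}})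
           (*-mono-≤ (0≤r b) (0≤r q) (cap≤ m) (cap≤ n))
           (∣p-q∣-intro b a (half n≥ m≥) (half m≥ n≥)) ⟩
    q⁻¹ ℚ.* q⁻¹ ℚ.* γ
      ≡⟨ solve 3 (λ q r δ → r :* r :* (q :* q :* δ) := (q :* r) :* (q :* r) :* δ) refl q q⁻¹ δ ⟩
    (q ℚ.* q⁻¹) ℚ.* (q ℚ.* q⁻¹) ℚ.* δ
      ≡⟨ cong (λ u → u ℚ.* u ℚ.* δ) (*-recip q) ⟩
    1ℚ ℚ.* 1ℚ ℚ.* δ
      ≡⟨ ℚ.*-identityˡ δ ⟩
    δ ∎

infixl 7 _÷_

_÷_ : ∀ x y {{_ : Positive y}} → ℝ
x ÷ y = x * inv y

-- Since 2^a ≤ Wⁿ⁺¹ < 2^(a+1) for a = ⌊log₂ Wⁿ⁺¹⌋, the n-th term is within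
-- 1/(n+1) of the real logarithm of W to base 2.
log₂ : ∀ W .{{_ : NonZero W}} → ℝ
seq (log₂ W) n = + ⌊log₂ W ℕ.^ suc n ⌋ ℚ./ suc n
cauchy (log₂ W) δ with archimedean δ
... | N , f = N , λ {m} {n} m≥ n≥ →
  ∣p-q∣-intro (l m) (l n)
    (ℚ.≤-trans (half m n) (ℚ.+-monoʳ-≤ (l n) (f n≥)))
    (ℚ.≤-trans (half n m) (ℚ.+-monoʳ-≤ (l m) (f m≥)))
  where
  a : ℕ → ℕ
  a n = ⌊log₂ W ℕ.^ suc n ⌋
  l : ℕ → ℚ
  l n = + a n ℚ./ suc n
  pow : ∀ m n → 2 ℕ.^ (a m ℕ.* suc n) ℕ.< 2 ℕ.^ (suc (a n) ℕ.* suc m)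
  pow m n = begin-strict
    2 ℕ.^ (a m ℕ.* suc n)              ≡⟨ ℕ.^-*-assoc 2 (a m) (suc n) ⟨
    (2 ℕ.^ a m) ℕ.^ suc n              ≤⟨ ℕ.^-monoˡ-≤ (suc n) (⌊log₂⌋-lower (W ℕ.^ suc m) {{ℕ.m^n≢0 W (suc m)}}) ⟩
    (W ℕ.^ suc m) ℕ.^ suc n            ≡⟨ ℕ.^-*-assoc W (suc m) (suc n) ⟩
    W ℕ.^ (suc m ℕ.* suc n)            ≡⟨ cong (W ℕ.^_) (ℕ.*-comm (suc m) (suc n)) ⟩
    W ℕ.^ (suc n ℕ.* suc m)            ≡⟨ ℕ.^-*-assoc W (suc n) (suc m) ⟨
    (W ℕ.^ suc n) ℕ.^ suc m            <⟨ ℕ.^-monoˡ-< (suc m) (⌊log₂⌋-upper (W ℕ.^ suc n)) ⟩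
    (2 ℕ.^ suc (a n)) ℕ.^ suc m        ≡⟨ ℕ.^-*-assoc 2 (suc (a n)) (suc m) ⟩
    2 ℕ.^ (suc (a n) ℕ.* suc m)        ∎
    where
    open ℕ.≤-Reasoning
  cross : ∀ m n → a m ℕ.* suc n ℕ.≤ (a n ℕ.+ 1) ℕ.* suc m
  cross m n with a m ℕ.* suc n ℕ.≤? suc (a n) ℕ.* suc m
  ... | yes p = subst (λ k → a m ℕ.* suc n ℕ.≤ k ℕ.* suc m) (ℕ.+-comm 1 (a n)) p
  ... | no ¬p = contradiction (ℕ.^-monoʳ-≤ 2 (ℕ.≰⇒≥ ¬p)) (ℕ.<⇒≱ (pow m n))
  half : ∀ m n → l m ℚ.≤ l n ℚ.+ + 1 ℚ./ suc n
  half m n = subst (l m ℚ.≤_) (sym (/-+ (a n) 1 n)) (/-mono (a m) m (a n ℕ.+ 1) n (cross m n))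

instance
  fromℕ-pos : ∀ {n} .{{_ : NonZero n}} → Positive (fromℕ n)
  fromℕ-pos {n} = record
    { bound   = + n ℚ./ 1
    ; bound>0 = ℚ.normalize-pos n 1
    ; from    = 0
    ; bound≤  = λ _ → ℚ.≤-refl
    }

  +-pos : ∀ {x y} {{_ : Positive x}} {{_ : Positive y}} → Positive (x + y)
  +-pos {{p}} {{q}} = record
    { bound   = bound p ℚ.+ bound q
    ; bound>0 = ℚ.pos+pos⇒pos (bound p) {{bound>0 p}} (bound q) {{bound>0 q}}
    ; from    = from p ℕ.⊔ from q
    ; bound≤  = λ h → ℚ.+-mono-≤ (bound≤ p (ℕ.m⊔n≤o⇒m≤o (from p) (from q) h))
                                 (bound≤ q (ℕ.m⊔n≤o⇒n≤o (from p) (from q) h))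
    }

  *-pos : ∀ {x y} {{_ : Positive x}} {{_ : Positive y}} → Positive (x * y)
  *-pos {{p}} {{q}} = record
    { bound   = bound p ℚ.* bound q
    ; bound>0 = ℚ.pos*pos⇒pos (bound p) {{bound>0 p}} (bound q) {{bound>0 q}}
    ; from    = from p ℕ.⊔ from q
    ; bound≤  = λ h →
        let p≤ = bound≤ p (ℕ.m⊔n≤o⇒m≤o (from p) (from q) h)
            q≤ = bound≤ q (ℕ.m⊔n≤o⇒n≤o (from p) (from q) h)
        in *-mono-≤ (0≤pos (bound q) {{bound>0 q}})
                    (ℚ.≤-trans (0≤pos (bound p) {{bound>0 p}}) p≤) p≤ q≤
    }

  inv-pos : ∀ {x} {{_ : Positive x}} → Positive (inv x)
  inv-pos {x} {{p}} = record
    { bound   = recip (B ℚ.⊔ q) {{cap>0 B}}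
    ; bound>0 = recip-pos (B ℚ.⊔ q) {{cap>0 B}}
    ; from    = proj₁ (proj₂ (proj₂ (bounded x)))
    ; bound≤  = λ {n} n≥ → recip-anti (seq x n ℚ.⊔ q) (B ℚ.⊔ q) {{cap>0 (seq x n)}} {{cap>0 B}}
        (ℚ.⊔-monoˡ-≤ q (ℚ.≤-trans (p≤∣p∣ (seq x n)) (proj₂ (proj₂ (proj₂ (bounded x))) n≥)))
    }
    where
    B = proj₁ (bounded x)
    q = bound p
    cap>0 : ∀ r → ℚ.Positive (r ℚ.⊔ q)
    cap>0 r = ⊔-pos r q {{bound>0 p}}

  ⊔-posʳ : ∀ {x y} {{_ : Positive y}} → Positive (x ⊔ y)
  ⊔-posʳ {x} {y} {{p}} = record
    { bound   = bound p
    ; bound>0 = bound>0 p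
    ; from    = from p
    ; bound≤  = λ {n} h → ℚ.≤-trans (bound≤ p h) (ℚ.p≤q⊔p (seq x n) (seq y n))
    }

≤-pos : ∀ {x y} {{_ : Positive x}} → x ≤ y → Positive y
≤-pos {x} {y} {{p}} x≤y with x≤y (½ ℚ.* bound p) {{½*pos (bound p) {{bound>0 p}}}}
... | N , f = record
  { bound   = ½ ℚ.* bound p
  ; bound>0 = ½*pos (bound p) {{bound>0 p}}
  ; from    = N ℕ.⊔ from p
  ; bound≤  = λ {n} h → begin
      ½ ℚ.* q                            ≡⟨ solve 1 (λ q → con ½ :* q := q :- con ½ :* q) refl q ⟩
      q ℚ.- ½ ℚ.* q                      ≤⟨ p≤q+δ⇒p-q≤δ q (½ ℚ.* q) (ℚ.≤-trans (bound≤ p (ℕ.m⊔n≤o⇒n≤o N (from p) h))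
                                              (subst (seq x n ℚ.≤_) (ℚ.+-comm (seq y n) (½ ℚ.* q))
                                                (f (ℕ.m⊔n≤o⇒m≤o N (from p) h)))) ⟩
      seq y n                            ∎
  }
  where
  open ℚ.≤-Reasoning
  open +-*-Solver
  q = bound p

record Admissible (W : ℕ) .{{_ : NonZero W}} (ε : ℝ) : Set where
  field
    1/2W≤ε : fromℕ 1 ÷ (fromℕ 2 * fromℕ W) ≤ ε
    ε≤1/4  : ε ≤ fromℕ 1 ÷ fromℕ 4

  ε>0 : Positive ε
  ε>0 = ≤-pos {fromℕ 1 ÷ (fromℕ 2 * fromℕ W)} 1/2W≤ε

-- The consumption 1/(2ε) + 2 log W + O(1) of the window-counting algorithm,
-- in bits: r is the value of the O(1) term. As r is later allowed to be any
-- bounded function of W and ε, no particular accounting of the bits is fixed.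
memory : ∀ W .{{_ : NonZero W}} ε {{_ : Positive ε}} → ℝ → ℝ
memory W ε r = fromℕ 1 ÷ (fromℕ 2 * ε) + fromℕ 2 * log₂ W + r

-- The lower bound, in bits, for Wε-additive approximations.
lowerBound : ∀ W .{{_ : NonZero W}} ε {{_ : Positive ε}} → ℝ
lowerBound W ε = log₂ W ⊔ (fromℕ 1 ÷ (fromℕ 2 * ε + inv (fromℕ W)))

ratio : ∀ W .{{_ : NonZero W}} ε {{_ : Positive ε}} → ℝ → ℝ
ratio W ε r = memory W ε r ÷ lowerBound W ε

-- The absolute constant c is chosen before W and ε.
IsBigO1 : (ℕ → ℝ → ℝ) → Set
IsBigO1 r = ∃[ c ] ∀ W .{{_ : NonZero W}} ε → Admissible W ε → ∣ r W ε ∣ ≤ fromℚ c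

-- η depends on W only, so a bound by η W is uniform in ε.
IsLittleO1 : (ℕ → ℝ) → Set
IsLittleO1 η = ∀ δ .{{_ : ℚ.Positive δ}} → ∃[ W₀ ] ∀ {W} → W₀ ℕ.≤ W → ∣ η W ∣ ≤ fromℚ δ

{-# OPTIONS --safe #-}
module Submission where

-- Write L = log W, t = 1/(2ε), w = 1/W, M = 1/(2ε + w), D = L ⊔ M and
-- u = t w. Then t = (1 + u) M and t = u W. At the ends of the range
-- 0 ≤ u ≤ 1 the ratio is governed by different terms: when u is near 0, both
-- t and 2 L count and give 1 + 2; when u is near 1, t alone gives up to 2,
-- while L is negligible against t. The splitting
--
--   t + 2 L = (1 + u) M + (2 - u) L + u L ≤ 3 D + u L
--
-- treats all cases at once, and the excess is small because
-- u L = t L / W = (1 + u) M L / W ≤ 3 D L / W. Since L ≥ 1 when W ≥ 2, a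
-- bounded term r ≤ K is at most (K / L) D, so the ratio exceeds 3 by no more
-- than 3 L / W + K / L, which tends to 0. The upper bound on ε serves only to
-- exclude W = 1.
--
-- To have a rational o(1) term, L is compared with s = ⌊log₂ W⌋ + 1: from
-- s / 2 ≤ L ≤ s and s * s ≤ 4 W the excess is at most (12 + 2 K) / s.
--
-- Real numbers being sequences of rationals, the estimate is proved for the
-- n-th terms with n large (memory-bound). There 1/(2W) ≤ ε holds only up to
-- an error, so the terms of u are only bounded by 2, which is still enough
-- for 2 - u to be nonnegative.

open import Data.Integer.Base as ℤ using (+_)
import Data.Integer.Properties as ℤ
open import Data.Nat.Base as ℕ using (ℕ; zero; suc; NonZero; s≤s; z≤n)
open import Data.Nat.Logarithm
import Data.Nat.Properties as ℕ
open import Data.Product.Base using (∃-syntax; _×_; _,_; proj₁; proj₂)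
open import Data.Rational.Base as ℚ using (ℚ; 0ℚ; 1ℚ; ½)
import Data.Rational.Properties as ℚ
open import Data.Rational.Solver using (module +-*-Solver)
open import Data.Rational.Unnormalised.Base as ℚᵘ using (mkℚᵘ)
import Data.Rational.Unnormalised.Properties as ℚᵘ
open import Relation.Binary.PropositionalEquality
open import Relation.Nullary using (¬_; contradiction)
open import Relation.Nullary.Decidable using (from-no)
open import Defs

-- Rational arithmetic

-- The natural number k as a rational.
⟦_⟧ : ℕ → ℚ
⟦ k ⟧ = + k ℚ./ 1

⟦⟧-* : ∀ a b → ⟦ a ⟧ ℚ.* ⟦ b ⟧ ≡ ⟦ a ℕ.* b ⟧
⟦⟧-* a b = ℚ.toℚᵘ-injective (begin
  ℚ.toℚᵘ (⟦ a ⟧ ℚ.* ⟦ b ⟧)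
    ≈⟨ ℚ.toℚᵘ-homo-* ⟦ a ⟧ ⟦ b ⟧ ⟩
  ℚ.toℚᵘ ⟦ a ⟧ ℚᵘ.* ℚ.toℚᵘ ⟦ b ⟧
    ≈⟨ ℚᵘ.*-cong (ℚ.toℚᵘ-fromℚᵘ (mkℚᵘ (+ a) 0)) (ℚ.toℚᵘ-fromℚᵘ (mkℚᵘ (+ b) 0)) ⟩
  mkℚᵘ (+ a ℤ.* + b) 0
    ≡⟨ cong (λ k → mkℚᵘ k 0) (sym (ℤ.pos-* a b)) ⟩
  mkℚᵘ (+ (a ℕ.* b)) 0
    ≈⟨ ℚ.toℚᵘ-fromℚᵘ (mkℚᵘ (+ (a ℕ.* b)) 0) ⟨
  ℚ.toℚᵘ ⟦ a ℕ.* b ⟧ ∎)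
  where
  open import Relation.Binary.Reasoning.Setoid ℚᵘ.≃-setoid

⟦⟧-mono : ∀ {a b} → a ℕ.≤ b → ⟦ a ⟧ ℚ.≤ ⟦ b ⟧
⟦⟧-mono {a} {b} a≤b = /-mono a 0 b 0 (ℕ.*-monoˡ-≤ 1 a≤b)

/suc-pos : ∀ a b .{{_ : NonZero a}} → ℚ.Positive (+ a ℚ./ suc b)
/suc-pos a b = ℚ.normalize-pos a (suc b)

⟦suc⟧*1/suc : ∀ l → ⟦ suc l ⟧ ℚ.* (+ 1 ℚ./ suc l) ≡ 1ℚ
⟦suc⟧*1/suc l = ℚ.toℚᵘ-injective (begin
  ℚ.toℚᵘ (⟦ suc l ⟧ ℚ.* (+ 1 ℚ./ suc l))
    ≈⟨ ℚ.toℚᵘ-homo-* ⟦ suc l ⟧ (+ 1 ℚ./ suc l) ⟩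
  ℚ.toℚᵘ ⟦ suc l ⟧ ℚᵘ.* ℚ.toℚᵘ (+ 1 ℚ./ suc l)
    ≈⟨ ℚᵘ.*-cong (ℚ.toℚᵘ-fromℚᵘ (mkℚᵘ (+ suc l) 0)) (ℚ.toℚᵘ-fromℚᵘ (mkℚᵘ (+ 1) l)) ⟩
  mkℚᵘ (+ suc l) 0 ℚᵘ.* mkℚᵘ (+ 1) l
    ≈⟨ ℚᵘ.*≡* (cong +_ (trans (ℕ.*-identityʳ (suc l ℕ.* 1))
         (trans (ℕ.*-comm (suc l) 1) (cong (λ k → 1 ℕ.* suc k) (sym (ℕ.+-identityʳ l)))))) ⟩
  ℚ.toℚᵘ 1ℚ ∎)
  where
  open import Relation.Binary.Reasoning.Setoid ℚᵘ.≃-setoid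

*-monoˡ : ∀ {p q} r → 0ℚ ℚ.≤ r → p ℚ.≤ q → r ℚ.* p ℚ.≤ r ℚ.* q
*-monoˡ r 0≤r = ℚ.*-monoˡ-≤-nonNeg r {{ℚ.nonNegative 0≤r}}

*-nonNeg : ∀ {p q} → 0ℚ ℚ.≤ p → 0ℚ ℚ.≤ q → 0ℚ ℚ.≤ p ℚ.* q
*-nonNeg {p} {q} 0≤p 0≤q = subst (ℚ._≤ p ℚ.* q) (ℚ.*-zeroʳ p) (*-monoˡ p 0≤p 0≤q)

-- The estimate for single terms, where x stands for 2ε and v for 1/s.
memory-bound : ∀ {x w t M L W v r K} →
  x ℚ.* t ≡ 1ℚ → (x ℚ.+ w) ℚ.* M ≡ 1ℚ → W ℚ.* w ≡ 1ℚ →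
  0ℚ ℚ.≤ t → 0ℚ ℚ.≤ w → 0ℚ ℚ.≤ M → 0ℚ ℚ.≤ v → 0ℚ ℚ.≤ K →
  w ℚ.≤ ⟦ 2 ⟧ ℚ.* x →
  L ℚ.≤ ⟦ 4 ⟧ ℚ.* v ℚ.* W →
  1ℚ ℚ.≤ ⟦ 2 ⟧ ℚ.* v ℚ.* L →
  r ℚ.≤ K →
  t ℚ.+ ⟦ 2 ⟧ ℚ.* L ℚ.+ r ℚ.≤ (⟦ 3 ⟧ ℚ.+ (⟦ 12 ⟧ ℚ.+ ⟦ 2 ⟧ ℚ.* K) ℚ.* v) ℚ.* (L ℚ.⊔ M)
memory-bound {x} {w} {t} {M} {L} {W} {v} {r} {K}
  xt≡1 [x+w]M≡1 Ww≡1 0≤t 0≤w 0≤M 0≤v 0≤K w≤2x L≤4vW 1≤2vL r≤K = begin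
  t ℚ.+ ⟦ 2 ⟧ ℚ.* L ℚ.+ r
    ≡⟨ cong (λ p → p ℚ.+ ⟦ 2 ⟧ ℚ.* L ℚ.+ r) t≡[1+u]M ⟩
  (1ℚ ℚ.+ u) ℚ.* M ℚ.+ ⟦ 2 ⟧ ℚ.* L ℚ.+ r
    ≡⟨ solve 4 (λ u M L r → (con 1ℚ :+ u) :* M :+ con ⟦ 2 ⟧ :* L :+ r
         := (con 1ℚ :+ u) :* M :+ (con ⟦ 2 ⟧ :- u) :* L :+ u :* L :+ r) refl u M L r ⟩
  (1ℚ ℚ.+ u) ℚ.* M ℚ.+ (⟦ 2 ⟧ ℚ.- u) ℚ.* L ℚ.+ u ℚ.* L ℚ.+ r
    ≤⟨ ℚ.+-mono-≤ (ℚ.+-mono-≤ (ℚ.+-mono-≤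
         (*-monoˡ (1ℚ ℚ.+ u) 0≤1+u M≤D) (*-monoˡ (⟦ 2 ⟧ ℚ.- u) 0≤2-u L≤D)) uL≤12vD) r≤2KvD ⟩
  (1ℚ ℚ.+ u) ℚ.* D ℚ.+ (⟦ 2 ⟧ ℚ.- u) ℚ.* D ℚ.+ ⟦ 12 ⟧ ℚ.* v ℚ.* D ℚ.+ K ℚ.* (⟦ 2 ⟧ ℚ.* v ℚ.* D)
    ≡⟨ solve 4 (λ u v K D →
         (con 1ℚ :+ u) :* D :+ (con ⟦ 2 ⟧ :- u) :* D :+ con ⟦ 12 ⟧ :* v :* D :+ K :* (con ⟦ 2 ⟧ :* v :* D)
         := (con ⟦ 3 ⟧ :+ (con ⟦ 12 ⟧ :+ con ⟦ 2 ⟧ :* K) :* v) :* D) refl u v K D ⟩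
  (⟦ 3 ⟧ ℚ.+ (⟦ 12 ⟧ ℚ.+ ⟦ 2 ⟧ ℚ.* K) ℚ.* v) ℚ.* D ∎
  where
  open ℚ.≤-Reasoning
  open +-*-Solver hiding (⟦_⟧)
  u D : ℚ
  u = t ℚ.* w
  D = L ℚ.⊔ M

  L≤D : L ℚ.≤ D
  L≤D = ℚ.p≤p⊔q L M

  M≤D : M ℚ.≤ D
  M≤D = ℚ.p≤q⊔p L M

  0≤u : 0ℚ ℚ.≤ u
  0≤u = *-nonNeg 0≤t 0≤w

  u≤2 : u ℚ.≤ ⟦ 2 ⟧
  u≤2 = begin
    t ℚ.* w                ≤⟨ *-monoˡ t 0≤t w≤2x ⟩
    t ℚ.* (⟦ 2 ⟧ ℚ.* x)    ≡⟨ solve 2 (λ t x → t :* (con ⟦ 2 ⟧ :* x) := con ⟦ 2 ⟧ :* (x :* t)) refl t x ⟩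
    ⟦ 2 ⟧ ℚ.* (x ℚ.* t)    ≡⟨ cong (⟦ 2 ⟧ ℚ.*_) xt≡1 ⟩
    ⟦ 2 ⟧                  ∎

  0≤1+u : 0ℚ ℚ.≤ 1ℚ ℚ.+ u
  0≤1+u = ℚ.+-mono-≤ (0≤pos 1ℚ) 0≤u

  0≤2-u : 0ℚ ℚ.≤ ⟦ 2 ⟧ ℚ.- u
  0≤2-u = subst (ℚ._≤ ⟦ 2 ⟧ ℚ.- u) (ℚ.+-inverseʳ u) (ℚ.+-monoˡ-≤ (ℚ.- u) u≤2)

  t≡[1+u]M : t ≡ (1ℚ ℚ.+ u) ℚ.* M
  t≡[1+u]M = begin-equality
    t                                  ≡⟨ ℚ.*-identityʳ t ⟨
    t ℚ.* 1ℚ                           ≡⟨ cong (t ℚ.*_) [x+w]M≡1 ⟨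
    t ℚ.* ((x ℚ.+ w) ℚ.* M)            ≡⟨ solve 4 (λ t x w M → t :* ((x :+ w) :* M) := (x :* t :+ t :* w) :* M) refl t x w M ⟩
    (x ℚ.* t ℚ.+ t ℚ.* w) ℚ.* M        ≡⟨ cong (λ p → (p ℚ.+ t ℚ.* w) ℚ.* M) xt≡1 ⟩
    (1ℚ ℚ.+ u) ℚ.* M                   ∎

  0≤4v : 0ℚ ℚ.≤ ⟦ 4 ⟧ ℚ.* v
  0≤4v = *-nonNeg (0≤pos ⟦ 4 ⟧) 0≤v

  uL≤12vD : u ℚ.* L ℚ.≤ ⟦ 12 ⟧ ℚ.* v ℚ.* D
  uL≤12vD = begin
    u ℚ.* L                                ≤⟨ *-monoˡ u 0≤u L≤4vW ⟩
    t ℚ.* w ℚ.* (⟦ 4 ⟧ ℚ.* v ℚ.* W)        ≡⟨ solve 4 (λ t w v W → t :* w :* (con ⟦ 4 ⟧ :* v :* W)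
                                                := con ⟦ 4 ⟧ :* v :* (t :* (W :* w))) refl t w v W ⟩
    ⟦ 4 ⟧ ℚ.* v ℚ.* (t ℚ.* (W ℚ.* w))      ≡⟨ cong (λ p → ⟦ 4 ⟧ ℚ.* v ℚ.* (t ℚ.* p)) Ww≡1 ⟩
    ⟦ 4 ⟧ ℚ.* v ℚ.* (t ℚ.* 1ℚ)             ≡⟨ cong (⟦ 4 ⟧ ℚ.* v ℚ.*_) (trans (ℚ.*-identityʳ t) t≡[1+u]M) ⟩
    ⟦ 4 ⟧ ℚ.* v ℚ.* ((1ℚ ℚ.+ u) ℚ.* M)     ≤⟨ *-monoˡ (⟦ 4 ⟧ ℚ.* v) 0≤4v
                                                (*-mono-≤ 0≤M (0≤pos ⟦ 3 ⟧) (ℚ.+-monoʳ-≤ 1ℚ u≤2) M≤D) ⟩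
    ⟦ 4 ⟧ ℚ.* v ℚ.* (⟦ 3 ⟧ ℚ.* D)          ≡⟨ solve 2 (λ v D → con ⟦ 4 ⟧ :* v :* (con ⟦ 3 ⟧ :* D)
                                                := con ⟦ 12 ⟧ :* v :* D) refl v D ⟩
    ⟦ 12 ⟧ ℚ.* v ℚ.* D                     ∎

  r≤2KvD : r ℚ.≤ K ℚ.* (⟦ 2 ⟧ ℚ.* v ℚ.* D)
  r≤2KvD = begin
    r                                ≤⟨ r≤K ⟩
    K                                ≡⟨ ℚ.*-identityʳ K ⟨
    K ℚ.* 1ℚ                         ≤⟨ *-monoˡ K 0≤K (ℚ.≤-trans 1≤2vL
                                          (*-monoˡ (⟦ 2 ⟧ ℚ.* v) (*-nonNeg (0≤pos ⟦ 2 ⟧) 0≤v) L≤D)) ⟩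
    K ℚ.* (⟦ 2 ⟧ ℚ.* v ℚ.* D)        ∎

-- Logarithms

l<2^l : ∀ l → suc l ℕ.≤ 2 ℕ.^ l
l<2^l zero    = ℕ.≤-refl
l<2^l (suc l) = begin
  suc (suc l)                      ≤⟨ ℕ.+-mono-≤ (ℕ.m^n>0 2 l) (l<2^l l) ⟩
  2 ℕ.^ l ℕ.+ 2 ℕ.^ l              ≡⟨ cong (2 ℕ.^ l ℕ.+_) (ℕ.+-identityʳ (2 ℕ.^ l)) ⟨
  2 ℕ.^ suc l                      ∎
  where
  open ℕ.≤-Reasoning

l*[1+l]≤2*2^l : ∀ l → l ℕ.* suc l ℕ.≤ 2 ℕ.* 2 ℕ.^ l
l*[1+l]≤2*2^l zero    = z≤n
l*[1+l]≤2*2^l (suc l) = begin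
  suc l ℕ.* suc (suc l)                  ≡⟨ ℕ.*-comm (suc l) (2 ℕ.+ l) ⟩
  (2 ℕ.+ l) ℕ.* suc l                    ≡⟨ ℕ.*-distribʳ-+ (suc l) 2 l ⟩
  2 ℕ.* suc l ℕ.+ l ℕ.* suc l            ≤⟨ ℕ.+-mono-≤ (ℕ.*-monoʳ-≤ 2 (l<2^l l)) (l*[1+l]≤2*2^l l) ⟩
  2 ℕ.* 2 ℕ.^ l ℕ.+ 2 ℕ.* 2 ℕ.^ l        ≡⟨ ℕ.*-distribˡ-+ 2 (2 ℕ.^ l) (2 ℕ.^ l) ⟨
  2 ℕ.* (2 ℕ.^ l ℕ.+ 2 ℕ.^ l)            ≡⟨ cong (λ k → 2 ℕ.* (2 ℕ.^ l ℕ.+ k)) (ℕ.+-identityʳ (2 ℕ.^ l)) ⟨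
  2 ℕ.* 2 ℕ.^ suc l                      ∎
  where
  open ℕ.≤-Reasoning

[1+⌊log₂⌋]²≤4* : ∀ W .{{_ : NonZero W}} → suc ⌊log₂ W ⌋ ℕ.* suc ⌊log₂ W ⌋ ℕ.≤ 4 ℕ.* W
[1+⌊log₂⌋]²≤4* W = begin
  suc l ℕ.* suc l              ≤⟨ ℕ.*-monoʳ-≤ (suc l) (ℕ.n≤1+n (suc l)) ⟩
  suc l ℕ.* suc (suc l)        ≤⟨ l*[1+l]≤2*2^l (suc l) ⟩
  2 ℕ.* (2 ℕ.* 2 ℕ.^ l)        ≡⟨ ℕ.*-assoc 2 2 (2 ℕ.^ l) ⟨
  4 ℕ.* 2 ℕ.^ l                ≤⟨ ℕ.*-monoʳ-≤ 4 (⌊log₂⌋-lower W) ⟩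
  4 ℕ.* W                      ∎
  where
  open ℕ.≤-Reasoning
  l = ⌊log₂ W ⌋

-- With k = n + 1, the next two lemmas say that the n-th term of log₂ W,
-- which is ⌊log₂ W ^ k ⌋ / k, lies between ⌊log₂ W ⌋ and ⌊log₂ W ⌋ + 1.
⌊log₂⌋*≤⌊log₂^⌋ : ∀ W .{{_ : NonZero W}} k → ⌊log₂ W ⌋ ℕ.* k ℕ.≤ ⌊log₂ W ℕ.^ k ⌋
⌊log₂⌋*≤⌊log₂^⌋ W k = begin
  l ℕ.* k                        ≡⟨ ⌊log₂[2^n]⌋≡n (l ℕ.* k) ⟨
  ⌊log₂ 2 ℕ.^ (l ℕ.* k) ⌋        ≡⟨ cong ⌊log₂_⌋ (ℕ.^-*-assoc 2 l k) ⟨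
  ⌊log₂ (2 ℕ.^ l) ℕ.^ k ⌋        ≤⟨ ⌊log₂⌋-mono-≤ (ℕ.^-monoˡ-≤ k (⌊log₂⌋-lower W)) ⟩
  ⌊log₂ W ℕ.^ k ⌋                ∎
  where
  open ℕ.≤-Reasoning
  l = ⌊log₂ W ⌋

⌊log₂^⌋≤[1+⌊log₂⌋]* : ∀ W k → ⌊log₂ W ℕ.^ k ⌋ ℕ.≤ suc ⌊log₂ W ⌋ ℕ.* k
⌊log₂^⌋≤[1+⌊log₂⌋]* W k = begin
  ⌊log₂ W ℕ.^ k ⌋                ≤⟨ ⌊log₂⌋-mono-≤ (ℕ.^-monoˡ-≤ k (ℕ.<⇒≤ (⌊log₂⌋-upper W))) ⟩
  ⌊log₂ (2 ℕ.^ s) ℕ.^ k ⌋        ≡⟨ cong ⌊log₂_⌋ (ℕ.^-*-assoc 2 s k) ⟩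
  ⌊log₂ 2 ℕ.^ (s ℕ.* k) ⌋        ≡⟨ ⌊log₂[2^n]⌋≡n (s ℕ.* k) ⟩
  s ℕ.* k                        ∎
  where
  open ℕ.≤-Reasoning
  s = suc ⌊log₂ W ⌋

-- 1/s for s = ⌊log₂ W ⌋ + 1.
1/s : ℕ → ℚ
1/s W = + 1 ℚ./ suc ⌊log₂ W ⌋

0≤1/s : ∀ W → 0ℚ ℚ.≤ 1/s W
0≤1/s W = 0≤pos (1/s W) {{/suc-pos 1 ⌊log₂ W ⌋}}

log₂≤4/s*W : ∀ W .{{_ : NonZero W}} n → seq (log₂ W) n ℚ.≤ ⟦ 4 ⟧ ℚ.* 1/s W ℚ.* ⟦ W ⟧
log₂≤4/s*W W n = begin
  seq (log₂ W) n                       ≤⟨ /-mono ⌊log₂ W ℕ.^ suc n ⌋ n s 0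
                                            (subst (ℕ._≤ s ℕ.* suc n) (sym (ℕ.*-identityʳ ⌊log₂ W ℕ.^ suc n ⌋))
                                              (⌊log₂^⌋≤[1+⌊log₂⌋]* W (suc n))) ⟩
  ⟦ s ⟧                                ≡⟨ ℚ.*-identityʳ ⟦ s ⟧ ⟨
  ⟦ s ⟧ ℚ.* 1ℚ                         ≡⟨ cong (⟦ s ⟧ ℚ.*_) (⟦suc⟧*1/suc ⌊log₂ W ⌋) ⟨
  ⟦ s ⟧ ℚ.* (⟦ s ⟧ ℚ.* v)              ≡⟨ solve 2 (λ S v → S :* (S :* v) := v :* (S :* S)) refl ⟦ s ⟧ v ⟩
  v ℚ.* (⟦ s ⟧ ℚ.* ⟦ s ⟧)              ≡⟨ cong (v ℚ.*_) (⟦⟧-* s s) ⟩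
  v ℚ.* ⟦ s ℕ.* s ⟧                    ≤⟨ *-monoˡ v (0≤1/s W) (⟦⟧-mono ([1+⌊log₂⌋]²≤4* W)) ⟩
  v ℚ.* ⟦ 4 ℕ.* W ⟧                    ≡⟨ cong (v ℚ.*_) (⟦⟧-* 4 W) ⟨
  v ℚ.* (⟦ 4 ⟧ ℚ.* ⟦ W ⟧)              ≡⟨ solve 2 (λ v W → v :* (con ⟦ 4 ⟧ :* W) := con ⟦ 4 ⟧ :* v :* W) refl v ⟦ W ⟧ ⟩
  ⟦ 4 ⟧ ℚ.* v ℚ.* ⟦ W ⟧                ∎
  where
  open ℚ.≤-Reasoning
  open +-*-Solver hiding (⟦_⟧)
  s = suc ⌊log₂ W ⌋
  v = 1/s W

1≤2/s*log₂ : ∀ W .{{_ : NonZero W}} → 2 ℕ.≤ W → ∀ n → 1ℚ ℚ.≤ ⟦ 2 ⟧ ℚ.* 1/s W ℚ.* seq (log₂ W) n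
1≤2/s*log₂ W 2≤W n = begin
  1ℚ                             ≡⟨ ⟦suc⟧*1/suc l ⟨
  ⟦ suc l ⟧ ℚ.* v                ≡⟨ ℚ.*-comm ⟦ suc l ⟧ v ⟩
  v ℚ.* ⟦ suc l ⟧                ≤⟨ *-monoˡ v (0≤1/s W) (/-mono (suc l) 0 (a ℕ.+ a) n s≤2L) ⟩
  v ℚ.* (+ (a ℕ.+ a) ℚ./ suc n)  ≡⟨ cong (v ℚ.*_) (/-+ a a n) ⟨
  v ℚ.* (L ℚ.+ L)                ≡⟨ solve 2 (λ v L → v :* (L :+ L) := con ⟦ 2 ⟧ :* v :* L) refl v L ⟩
  ⟦ 2 ⟧ ℚ.* v ℚ.* L              ∎
  where
  open ℚ.≤-Reasoning
  open +-*-Solver hiding (⟦_⟧)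
  l = ⌊log₂ W ⌋
  a = ⌊log₂ W ℕ.^ suc n ⌋
  v = 1/s W
  L = seq (log₂ W) n
  s≤2L : suc l ℕ.* suc n ℕ.≤ (a ℕ.+ a) ℕ.* 1
  s≤2L = R.begin
    suc l ℕ.* suc n                  R.≤⟨ ℕ.*-monoˡ-≤ (suc n) (ℕ.+-monoˡ-≤ l (⌊log₂⌋-mono-≤ 2≤W)) ⟩
    (l ℕ.+ l) ℕ.* suc n              R.≡⟨ ℕ.*-distribʳ-+ (suc n) l l ⟩
    l ℕ.* suc n ℕ.+ l ℕ.* suc n      R.≤⟨ ℕ.+-mono-≤ (⌊log₂⌋*≤⌊log₂^⌋ W (suc n)) (⌊log₂⌋*≤⌊log₂^⌋ W (suc n)) ⟩
    a ℕ.+ a                          R.≡⟨ ℕ.*-identityʳ (a ℕ.+ a) ⟨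
    (a ℕ.+ a) ℕ.* 1                  R.∎
    where module R = ℕ.≤-Reasoning

-- Terms of real numbers far out in the sequence

-- P holds for all sufficiently large indices.
Eventually : (ℕ → Set) → Set
Eventually P = ∃[ N ] ∀ {n} → N ℕ.≤ n → P n

infixr 2 _∩_

_∩_ : ∀ {P Q : ℕ → Set} → Eventually P → Eventually Q → Eventually (λ n → P n × Q n)
(M , f) ∩ (N , g) = M ℕ.⊔ N , λ h → f (ℕ.m⊔n≤o⇒m≤o M N h) , g (ℕ.m⊔n≤o⇒n≤o M N h)

map : ∀ {P Q : ℕ → Set} → (∀ {n} → P n → Q n) → Eventually P → Eventually Q
map i (N , f) = N , λ h → i (f h)

inv-nonNeg : ∀ x {{_ : Positive x}} n → 0ℚ ℚ.≤ seq (inv x) n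
inv-nonNeg x {{p}} n = 0≤pos (recip c) {{recip-pos c}}
  where
  c = seq x n ℚ.⊔ Positive.bound p
  instance
    c>0 : ℚ.Positive c
    c>0 = ⊔-pos (seq x n) (Positive.bound p) {{Positive.bound>0 p}}

-- The cap in the definition of inv is inactive from some term on.
*-inv : ∀ x {{_ : Positive x}} → Eventually (λ n → seq x n ℚ.* seq (inv x) n ≡ 1ℚ)
*-inv x {{p}} = Positive.from p , λ {n} h →
  let instance c>0 = ⊔-pos (seq x n) (Positive.bound p) {{Positive.bound>0 p}}
  in trans
    (cong (ℚ._* seq (inv x) n) (sym (ℚ.p≥q⇒p⊔q≡p (Positive.bound≤ p h))))
    (*-recip (seq x n ℚ.⊔ Positive.bound p))

-- For a positive constant the cap is never active.
inv-fromℕ : ∀ W .{{_ : NonZero W}} n → ⟦ W ⟧ ℚ.* seq (inv (fromℕ W)) n ≡ 1ℚ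
inv-fromℕ W n = proj₂ (*-inv (fromℕ W)) {n} z≤n

-- Division of an inequality by d, where e is the reciprocal of d.
÷-≤ : ∀ p q {d e} → d ℚ.* e ≡ 1ℚ → 0ℚ ℚ.≤ e → p ℚ.≤ q ℚ.* d → p ℚ.* e ℚ.≤ q
÷-≤ p q {d} {e} de≡1 0≤e p≤qd = begin
  p ℚ.* e                ≤⟨ ℚ.*-monoʳ-≤-nonNeg e {{ℚ.nonNegative 0≤e}} p≤qd ⟩
  q ℚ.* d ℚ.* e          ≡⟨ ℚ.*-assoc q d e ⟩
  q ℚ.* (d ℚ.* e)        ≡⟨ cong (q ℚ.*_) de≡1 ⟩
  q ℚ.* 1ℚ               ≡⟨ ℚ.*-identityʳ q ⟩
  q                      ∎
  where
  open ℚ.≤-Reasoning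

-- The window size

-- For W = 1 the bounds on ε read 1/2 ≤ ε ≤ 1/4. An error of 1/16 on each side
-- is small enough for the contradiction to show in the terms.
W≢1 : ∀ {ε} → ¬ Admissible 1 ε
W≢1 {ε} adm with 1/2W≤ε (+ 1 ℚ./ 16) ∩ ε≤1/4 (+ 1 ℚ./ 16)
  where open Admissible adm
... | N , f = from-no (½ ℚ.≤? + 1 ℚ./ 4 ℚ.+ + 1 ℚ./ 16 ℚ.+ + 1 ℚ./ 16)
  (ℚ.≤-trans (proj₁ (f ℕ.≤-refl)) (ℚ.+-monoˡ-≤ (+ 1 ℚ./ 16) (proj₂ (f ℕ.≤-refl))))

admissible⇒2≤W : ∀ {W} .{{_ : NonZero W}} {ε} → Admissible W ε → 2 ℕ.≤ W
admissible⇒2≤W {suc zero}    adm = contradiction adm W≢1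
admissible⇒2≤W {suc (suc W)} adm = s≤s (s≤s z≤n)

-- 1/(2W) ≤ ε holds for the terms up to the error w/4, where w = 1/W; this
-- leaves half of the bound w ≤ 2ε.
w≤4ε : ∀ {W} .{{_ : NonZero W}} {ε} → Admissible W ε →
       Eventually (λ n → seq (inv (fromℕ W)) n ℚ.≤ ⟦ 2 ⟧ ℚ.* (⟦ 2 ⟧ ℚ.* seq ε n))
w≤4ε {W} {ε} adm = map (λ {n} → bound (seq ε n)) (Admissible.1/2W≤ε adm δ)
  where
  open ℚ.≤-Reasoning
  open +-*-Solver hiding (⟦_⟧)
  w g : ℚ
  w = seq (inv (fromℕ W)) 0
  g = seq (inv (fromℕ 2 * fromℕ W)) 0

  δ : ℚ
  δ = + 1 ℚ./ 4 ℚ.* w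

  instance
    δ>0 : ℚ.Positive δ
    δ>0 = ℚ.pos*pos⇒pos (+ 1 ℚ./ 4) w {{recip-pos c}}
      where
      c = ⟦ W ⟧ ℚ.⊔ ⟦ W ⟧
      instance
        c>0 : ℚ.Positive c
        c>0 = ⊔-pos ⟦ W ⟧ ⟦ W ⟧ {{ℚ.normalize-pos W 1}}

  2g≡w : ⟦ 2 ⟧ ℚ.* g ≡ w
  2g≡w = begin-equality
    ⟦ 2 ⟧ ℚ.* g                        ≡⟨ ℚ.*-identityʳ (⟦ 2 ⟧ ℚ.* g) ⟨
    ⟦ 2 ⟧ ℚ.* g ℚ.* 1ℚ                 ≡⟨ cong (⟦ 2 ⟧ ℚ.* g ℚ.*_) (inv-fromℕ W 0) ⟨
    ⟦ 2 ⟧ ℚ.* g ℚ.* (⟦ W ⟧ ℚ.* w)      ≡⟨ solve 3 (λ g W w → con ⟦ 2 ⟧ :* g :* (W :* w)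
                                            := con ⟦ 2 ⟧ :* W :* g :* w) refl g ⟦ W ⟧ w ⟩
    ⟦ 2 ⟧ ℚ.* ⟦ W ⟧ ℚ.* g ℚ.* w        ≡⟨ cong (ℚ._* w) (proj₂ (*-inv (fromℕ 2 * fromℕ W)) {0} z≤n) ⟩
    1ℚ ℚ.* w                           ≡⟨ ℚ.*-identityˡ w ⟩
    w                                  ∎

  bound : ∀ e → 1ℚ ℚ.* g ℚ.≤ e ℚ.+ δ → w ℚ.≤ ⟦ 2 ⟧ ℚ.* (⟦ 2 ⟧ ℚ.* e)
  bound e g≤e+δ = begin
    w                                        ≡⟨ solve 1 (λ w → w := con ⟦ 2 ⟧ :* w :- w) refl w ⟩
    ⟦ 2 ⟧ ℚ.* w ℚ.- w                        ≡⟨ cong (λ p → ⟦ 2 ⟧ ℚ.* p ℚ.- w) 2g≡w ⟨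
    ⟦ 2 ⟧ ℚ.* (⟦ 2 ⟧ ℚ.* g) ℚ.- w            ≡⟨ solve 2 (λ g w → con ⟦ 2 ⟧ :* (con ⟦ 2 ⟧ :* g) :- w
                                                  := con ⟦ 4 ⟧ :* (con 1ℚ :* g) :- w) refl g w ⟩
    ⟦ 4 ⟧ ℚ.* (1ℚ ℚ.* g) ℚ.- w               ≤⟨ ℚ.+-monoˡ-≤ (ℚ.- w) (*-monoˡ ⟦ 4 ⟧ (0≤pos ⟦ 4 ⟧) g≤e+δ) ⟩
    ⟦ 4 ⟧ ℚ.* (e ℚ.+ δ) ℚ.- w                ≡⟨ solve 2 (λ e w → con ⟦ 4 ⟧ :* (e :+ con (+ 1 ℚ./ 4) :* w) :- w
                                                  := con ⟦ 2 ⟧ :* (con ⟦ 2 ⟧ :* e)) refl e w ⟩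
    ⟦ 2 ⟧ ℚ.* (⟦ 2 ⟧ ℚ.* e)                  ∎

-- The o(1) term

littleO1-1/s : ∀ C .{{_ : ℚ.Positive C}} → IsLittleO1 (λ W → fromℚ (C ℚ.* 1/s W))
littleO1-1/s C δ = 2 ℕ.^ N , λ {W} 2^N≤W γ → 0 , λ _ → begin
  C ℚ.* 1/s W ℚ.⊔ ℚ.- (C ℚ.* 1/s W)    ≡⟨ ℚ.p≥q⇒p⊔q≡p (ℚ.≤-trans (ℚ.neg-antimono-≤ (0≤C/s W)) (0≤C/s W)) ⟩
  C ℚ.* 1/s W                          ≤⟨ *-monoˡ C (0≤pos C) (proj₂ arch (N≤⌊log₂⌋ 2^N≤W)) ⟩
  C ℚ.* (recip C ℚ.* δ)                ≡⟨ ℚ.*-assoc C (recip C) δ ⟨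
  C ℚ.* recip C ℚ.* δ                  ≡⟨ cong (ℚ._* δ) (*-recip C) ⟩
  1ℚ ℚ.* δ                             ≡⟨ ℚ.*-identityˡ δ ⟩
  δ                                    ≡⟨ ℚ.+-identityʳ δ ⟨
  δ ℚ.+ 0ℚ                             ≤⟨ ℚ.+-monoʳ-≤ δ (0≤pos γ) ⟩
  δ ℚ.+ γ                              ∎
  where
  open ℚ.≤-Reasoning
  arch = archimedean (recip C ℚ.* δ) {{ℚ.pos*pos⇒pos (recip C) {{recip-pos C}} δ}}
  N = proj₁ arch
  0≤C/s : ∀ W → 0ℚ ℚ.≤ C ℚ.* 1/s W
  0≤C/s W = *-nonNeg (0≤pos C) (0≤1/s W)
  N≤⌊log₂⌋ : ∀ {W} → 2 ℕ.^ N ℕ.≤ W → N ℕ.≤ ⌊log₂ W ⌋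
  N≤⌊log₂⌋ {W} h = subst (ℕ._≤ ⌊log₂ W ⌋) (⌊log₂[2^n]⌋≡n N) (⌊log₂⌋-mono-≤ h)

-- Comparison of the two memory bounds

-- The bound on the O(1) term r is raised from c to K = ∣ c ∣ + 1, which is
-- nonnegative and bounds the terms of r exactly from some index on.
ratio-bound : ∀ {W} .{{_ : NonZero W}} {ε} {{ε>0 : Positive ε}} → Admissible W ε → ∀ r c →
  ∣ r ∣ ≤ fromℚ c →
  ratio W ε r ≤
  fromℕ 3 + fromℚ ((⟦ 12 ⟧ ℚ.+ ⟦ 2 ⟧ ℚ.* (ℚ.∣ c ∣ ℚ.+ 1ℚ)) ℚ.* 1/s W)
ratio-bound {W} {ε} adm r c ∣r∣≤c δ = map
  (λ {n} (p₁ , p₂ , p₃ , p₄ , p₅) → term n p₁ p₂ p₃ p₄ p₅)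
  (*-inv x ∩ *-inv y ∩ *-inv D ∩ w≤4ε adm ∩ ∣r∣≤c 1ℚ)
  where
  open ℚ.≤-Reasoning
  x y D : ℝ
  x = fromℕ 2 * ε
  y = fromℕ 2 * ε + inv (fromℕ W)
  D = lowerBound W ε
  K : ℚ
  K = ℚ.∣ c ∣ ℚ.+ 1ℚ
  R : ℚ
  R = ⟦ 3 ⟧ ℚ.+ (⟦ 12 ⟧ ℚ.+ ⟦ 2 ⟧ ℚ.* K) ℚ.* 1/s W
  0≤K : 0ℚ ℚ.≤ K
  0≤K = ℚ.+-mono-≤ (ℚ.0≤∣p∣ c) (0≤pos 1ℚ)

  term : ∀ n →
    seq x n ℚ.* seq (inv x) n ≡ 1ℚ →
    seq y n ℚ.* seq (inv y) n ≡ 1ℚ →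
    seq D n ℚ.* seq (inv D) n ≡ 1ℚ →
    seq (inv (fromℕ W)) n ℚ.≤ ⟦ 2 ⟧ ℚ.* (⟦ 2 ⟧ ℚ.* seq ε n) →
    seq ∣ r ∣ n ℚ.≤ c ℚ.+ 1ℚ →
    seq (memory W ε r) n ℚ.* seq (inv D) n ℚ.≤ R ℚ.+ δ
  term n x*x⁻¹≡1 y*y⁻¹≡1 D*D⁻¹≡1 w≤4ε ∣r∣≤c+1 = begin
    seq (memory W ε r) n ℚ.* seq (inv D) n
      ≤⟨ ÷-≤ (seq (memory W ε r) n) R D*D⁻¹≡1 (inv-nonNeg D n) memory≤ ⟩
    R
      ≡⟨ ℚ.+-identityʳ R ⟨
    R ℚ.+ 0ℚ
      ≤⟨ ℚ.+-monoʳ-≤ R (0≤pos δ) ⟩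
    R ℚ.+ δ ∎
    where
    L t M rₙ : ℚ
    L = seq (log₂ W) n
    t = seq (inv x) n
    M = seq (inv y) n
    rₙ = seq r n

    r≤K : rₙ ℚ.≤ K
    r≤K = ℚ.≤-trans (ℚ.p≤p⊔q rₙ (ℚ.- rₙ)) (ℚ.≤-trans ∣r∣≤c+1 (ℚ.+-monoˡ-≤ 1ℚ (p≤∣p∣ c)))

    -- The quotients 1 ÷ x and 1 ÷ y have terms 1ℚ * t and 1ℚ * M.
    memory≤ : 1ℚ ℚ.* t ℚ.+ ⟦ 2 ⟧ ℚ.* L ℚ.+ rₙ ℚ.≤ R ℚ.* (L ℚ.⊔ 1ℚ ℚ.* M)
    memory≤ = subst₂ (λ t M → t ℚ.+ ⟦ 2 ⟧ ℚ.* L ℚ.+ rₙ ℚ.≤ R ℚ.* (L ℚ.⊔ M))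
      (sym (ℚ.*-identityˡ t)) (sym (ℚ.*-identityˡ M))
      (memory-bound {x = seq x n} {w = seq (inv (fromℕ W)) n} {t = t} {M = M} {L = L}
          {W = ⟦ W ⟧} {v = 1/s W} {r = rₙ} {K = K}
        x*x⁻¹≡1 y*y⁻¹≡1 (inv-fromℕ W n)
        (inv-nonNeg x n) (inv-nonNeg (fromℕ W) n) (inv-nonNeg y n) (0≤1/s W) 0≤K
        w≤4ε (log₂≤4/s*W W n) (1≤2/s*log₂ W (admissible⇒2≤W adm) n) r≤K)

corollary9 : ∀ (r : ℕ → ℝ → ℝ) → IsBigO1 r →
    ∃[ η ] IsLittleO1 η ×
    (∀ W .{{_ : NonZero W}} ε (adm : Admissible W ε) →
    ratio W ε {{Admissible.ε>0 adm}} (r W ε) ≤ fromℕ 3 + η W)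
corollary9 r (c , r≤c) =
  (λ W → fromℚ (C ℚ.* 1/s W)) , littleO1-1/s C , λ W ε adm → ratio-bound {{ε>0 = Admissible.ε>0 adm}} adm (r W ε) c (r≤c W ε adm)
  where
  C : ℚ
  C = ⟦ 12 ⟧ ℚ.+ ⟦ 2 ⟧ ℚ.* (ℚ.∣ c ∣ ℚ.+ 1ℚ)
  instance
    C>0 : ℚ.Positive C
    C>0 = ℚ.pos+nonNeg⇒pos ⟦ 12 ⟧ (⟦ 2 ⟧ ℚ.* (ℚ.∣ c ∣ ℚ.+ 1ℚ))
      {{ℚ.nonNegative (*-nonNeg (0≤pos ⟦ 2 ⟧) (ℚ.+-mono-≤ (ℚ.0≤∣p∣ c) (0≤pos 1ℚ)))}}
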